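{- Let $G$ be a finite simple graph without isolated vertices, $n=|V(G)|$, and $\varphi=\varphi(G)$. Then $2^{lu(G)}\le obdd(\varphi)\le n^{O(lu(G))}$; that is, $obdd(\varphi)\ge 2^{lu(G)}$, and there is an absolute constant $c>0$ (independent of $G$) such that $obdd(\varphi)\le n^{c\cdot lu(G)}$.
   Context: $\varphi(G)$ is the monotone 2-CNF with variable set $V(G)$ and a clause $(u\vee v)$ for each edge $\{u,v\}\in E(G)$. An OBDD is a directed acyclic graph with one source and two sinks labelled true and false, each non-sink node labelled by a variable and having exactly two outgoing edges labelled $x$ and $\neg x$ where $x$ is its label; no variable appears twice on any directed path, and there is a permutation of the variables such that along every path the node labels appear in the order of this permutation. It represents the function that is true on a total assignment $S$ iff there is a source-to-true-sink path all of whose edge labels belong to $S$. $obdd(\varphi)$ is the minimum number of nodes of an OBDD representing the Boolean function of $\varphi$. For $U\subseteq V(G)$, the upper subgraph $G^U$ is the spanning subgraph of $G$ obtained by deleting all edges with both ends in $V(G)\setminus U$. For sets $U,W$ of vertices of a graph $H$, an induced $(U,W)$-matching of $H$ is a matching of $H$ each edge of which has one end in $U$ and the other in $W$, such that the subgraph of $H$ induced by the endpoints of the matching has no edges other than the matching edges. For a permutation $\pi=(v_1,\dots,v_n)$ of $V(G)$, let $V_i=\{v_1,\dots,v_i\}$, let $r_i$ be the largest size of an induced $(V_i,V(G)\setminus V_i)$-matching of $G^{V_i}$, and $r(\pi)=\max_i r_i$. The linear upper maximum induced matching width $lu(G)$ is the minimum of $r(\pi)$ over all permutations $\pi$ of $V(G)$.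 -}

module Defs where

open import Data.Nat using (ℕ; zero; suc; _≤_; _<_; _^_; _*_)
open import Data.Bool using (Bool; true; false)
open import Data.Fin using (Fin; toℕ)
open import Data.Fin.Permutation using (Permutation′; _⟨$⟩ʳ_; _⟨$⟩ˡ_)
open import Data.Product using (Σ; Σ-syntax; _×_; _,_)
open import Data.Sum using (_⊎_)
open import Relation.Nullary using (¬_)
open import Relation.Binary.PropositionalEquality using (_≡_; _≢_)
open import Function.Bundles using (_⇔_)

record Graph (n : ℕ) : Set where
  field
    adj   : Fin n → Fin n → Bool
    sym   : ∀ u v → adj u v ≡ adj v u
    irrefl : ∀ v → adj v v ≡ false

open Graph public

Edge : ∀ {n} → Graph n → Fin n → Fin n → Set
Edge G u v = adj G u v ≡ true

NoIsolated : ∀ {n} → Graph n → Set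
NoIsolated {n} G = ∀ (v : Fin n) → Σ (Fin n) λ u → Edge G v u

-- The monotone 2-CNF φ(G): clause (u ∨ v) for every edge.
-- A total assignment is S : Fin n → Bool (S v ≡ true means the literal v ∈ S).

Assignment : ℕ → Set
Assignment n = Fin n → Bool

Satisfiesφ : ∀ {n} → Graph n → Assignment n → Set
Satisfiesφ {n} G S = ∀ (u v : Fin n) → Edge G u v → S u ≡ true ⊎ S v ≡ true

data Node (n m : ℕ) : Set where
  leaf   : Bool → Node n m
  -- branch x lo hi : node labelled x, edge ¬x goes to lo, edge x goes to hi
  branch : Fin n → Fin m → Fin m → Node n m

record OBDD (n : ℕ) : Set where
  field
    size      : ℕ
    node      : Fin size → Node n size
    source    : Fin size
    trueSink  : Fin size
    falseSink : Fin size
    trueSink-leaf  : node trueSink ≡ leaf true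
    falseSink-leaf : node falseSink ≡ leaf false
    true-unique  : ∀ x → node x ≡ leaf true → x ≡ trueSink
    false-unique : ∀ x → node x ≡ leaf false → x ≡ falseSink
    one-source : ∀ y → y ≢ source →
                 Σ (Fin size) λ x → Σ (Fin n) λ v → Σ (Fin size) λ lo → Σ (Fin size) λ hi →
                 node x ≡ branch v lo hi × (lo ≡ y ⊎ hi ≡ y)
    -- variable order (position of variable v is toℕ (order ⟨$⟩ˡ v));
    -- labels strictly increase along every edge, which gives acyclicity,
    -- no repeated variable on a path, and consistency with the order.
    order   : Permutation′ n
    ordered : ∀ x v lo hi → node x ≡ branch v lo hi →
              ∀ c → (c ≡ lo ⊎ c ≡ hi) →
              ∀ w l h → node c ≡ branch w l h →
              toℕ (order ⟨$⟩ˡ v) < toℕ (order ⟨$⟩ˡ w)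

open OBDD public

data Path {n : ℕ} (B : OBDD n) (S : Assignment n) : Fin (size B) → Fin (size B) → Set where
  here  : ∀ x → Path B S x x
  stepT : ∀ x v lo hi y → node B x ≡ branch v lo hi → S v ≡ true →
          Path B S hi y → Path B S x y
  stepF : ∀ x v lo hi y → node B x ≡ branch v lo hi → S v ≡ false →
          Path B S lo y → Path B S x y

Accepts : ∀ {n} → OBDD n → Assignment n → Set
Accepts B S = Path B S (source B) (trueSink B)

Represents : ∀ {n} → OBDD n → Graph n → Set
Represents {n} B G = ∀ (S : Assignment n) → Accepts B S ⇔ Satisfiesφ G S

VSet : ℕ → Set₁
VSet n = Fin n → Set

UpperEdge : ∀ {n} → Graph n → VSet n → Fin n → Fin n → Set
UpperEdge G U x y = Edge G x y × (U x ⊎ U y)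

record IndMatching {n : ℕ} (G : Graph n) (U : VSet n) (k : ℕ) : Set where
  field
    left     : Fin k → Fin n
    right    : Fin k → Fin n
    left∈U   : ∀ i → U (left i)
    right∉U  : ∀ i → ¬ U (right i)
    matchEdge : ∀ i → UpperEdge G U (left i) (right i)
    left-inj  : ∀ i j → left i ≡ left j → i ≡ j
    right-inj : ∀ i j → right i ≡ right j → i ≡ j
    induced-ll : ∀ i j → i ≢ j → ¬ UpperEdge G U (left i) (left j)
    induced-lr : ∀ i j → i ≢ j → ¬ UpperEdge G U (left i) (right j)
    induced-rr : ∀ i j → i ≢ j → ¬ UpperEdge G U (right i) (right j)

-- V_i = {v_1, …, v_i} for π = (v_1, …, v_n), with v_{j+1} = π ⟨$⟩ʳ j
Prefix : ∀ {n} → Permutation′ n → ℕ → VSet n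
Prefix π i v = toℕ (π ⟨$⟩ˡ v) < i

Is-r-i : ∀ {n} → Graph n → Permutation′ n → ℕ → ℕ → Set
Is-r-i G π i r = IndMatching G (Prefix π i) r × (∀ m → IndMatching G (Prefix π i) m → m ≤ r)

Is-r : ∀ {n} → Graph n → Permutation′ n → ℕ → Set
Is-r {n} G π r =
  (Σ ℕ λ i → 1 ≤ i × i ≤ n × Is-r-i G π i r) ×
  (∀ i → 1 ≤ i → i ≤ n → ∀ ri → Is-r-i G π i ri → ri ≤ r)

IsLu : ∀ {n} → Graph n → ℕ → Set
IsLu {n} G k =
  (Σ (Permutation′ n) λ π → Is-r G π k) ×
  (∀ (π : Permutation′ n) r → Is-r G π r → k ≤ r)

module Submission where

-- An order π defines r(π) through finitely many finite structures, so lu is found by exhaustive search.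
--
-- Lower bound.  Let u₁w₁, …, uᵣwᵣ be an induced matching across a prefix V of the order of an OBDD.
-- Make uₗ false for l in a chosen subset T of the indices and every other vertex of V true.  If j ∈ T ∖ T′
-- then, making wⱼ false and all other vertices outside V true, the formula is falsified
-- with T and satisfied with T′; hence the 2ʳ computations leave V at 2ʳ different nodes.
--
-- Upper bound.  After reading a prefix V without falsifying a clause, the residual function depends only on
-- the set N(F) ∖ V of forced vertices, where F ⊆ V is the independent set of vertices read as false.
-- A subset F′ of F that is inclusion-minimal with N(F′) ∖ V = N(F) ∖ V is matched to private
-- neighbours outside V, and this matching is induced in the upper subgraph, so |F′| ≤ r(π).
-- Hence there are at most (n + 1)^r(π) states per level.

open import Defs
open import Data.Nat using (ℕ; zero; suc; _+_; _≤_; _<_; _^_; _*_; z≤n; s≤s; _≤?_; _<?_)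
open import Data.Nat.Properties
open import Data.Bool using (Bool; true; false; _∧_; _∨_; not; if_then_else_)
open import Data.Bool.ListAction using (any)
import Data.Bool.Properties as Bool
open import Data.Empty using (⊥-elim)
open import Data.Unit using (⊤; tt)
open import Data.Fin as Fin using (Fin; toℕ; fromℕ<; finToFun; funToFin)
open import Data.Fin.Properties as Fin using (any?; all?; toℕ<n; toℕ-fromℕ<; fromℕ<-toℕ; toℕ-injective; injective⇒≤; funToFin-finToFin)
open import Data.Fin.Permutation as Perm using (Permutation′; _⟨$⟩ʳ_; _⟨$⟩ˡ_; permutation; inverseˡ; inverseʳ)
open import Data.List as List using (List; []; _∷_; map; length; concatMap; concat; applyUpTo; allFin; cartesianProductWith; deduplicate)
open import Data.List.Properties using (length-map; length-++; length-tabulate)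
open import Data.List.Membership.Propositional using (_∈_; lose; find)
open import Data.List.Membership.Propositional.Properties using (∈-lookup; ∈-allFin; ∈-cartesianProductWith⁺; ∈-concatMap⁺; ∈-concatMap⁻; ∈-concat⁺′; ∈-concat⁻′; ∈-applyUpTo⁺; ∈-applyUpTo⁻; ∈-deduplicate⁺; ∈-deduplicate⁻)
import Data.List.Membership.DecPropositional as DecMembership
open import Data.List.Relation.Unary.All as All using (All; []; _∷_)
open import Data.List.Relation.Unary.AllPairs using (AllPairs; []; _∷_)
open import Data.List.Relation.Unary.Any as Any using (here; there)
open import Data.List.Relation.Unary.Any.Properties using (lookup-index)
open import Data.List.Relation.Unary.Unique.Propositional using (Unique)
open import Data.List.Relation.Unary.Unique.DecPropositional.Properties using (deduplicate-!)
open import Data.Product using (Σ; Σ-syntax; ∃; _×_; _,_; proj₁; proj₂; swap)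
import Data.Product.Properties as Product
open import Data.Sum using (_⊎_; inj₁; inj₂)
import Data.Sum.Properties as Sum
open import Data.Vec as Vec using (Vec; []; _∷_; lookup; tabulate)
import Data.Vec.Properties as Vec
open import Data.Vec.Properties using (lookup∘tabulate; tabulate-cong)
open import Function using (_∘_; id)
open import Function.Bundles using (Equivalence; mk⇔)
open import Relation.Nullary using (¬_; Dec; yes; no)
open import Relation.Nullary.Decidable using (map′; _×-dec_; _⊎-dec_; _→-dec_; ¬?; ⌊_⌋)
open import Relation.Unary using (Decidable)
open import Relation.Binary.Definitions using (DecidableEquality)
open import Relation.Binary.PropositionalEquality using (_≡_; _≢_; refl; cong; cong₂; subst; subst₂; trans)
  renaming (sym to ≡-sym)

-- Existence of lu

any-Vec? : {A : Set} → (∀ {P : A → Set} → Decidable P → Dec (∃ P)) →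
           ∀ {k} {P : Vec A k → Set} → Decidable P → Dec (∃ P)
any-Vec? search {zero} P? = map′ ([] ,_) (λ { ([] , p) → p }) (P? [])
any-Vec? search {suc k} P? =
  map′ (λ { (x , xs , p) → x ∷ xs , p }) (λ { (x ∷ xs , p) → x , xs , p })
       (search (λ x → any-Vec? search (λ xs → P? (x ∷ xs))))

bounded-maximum : {P : ℕ → Set} → Decidable P → P 0 → ∀ N → (∀ m → P m → m ≤ N) →
                  Σ[ r ∈ ℕ ] P r × (∀ m → P m → m ≤ r)
bounded-maximum P? P0 zero bound = 0 , P0 , bound
bounded-maximum P? P0 (suc N) bound with P? (suc N)
... | yes p = suc N , p , bound
... | no ¬p = bounded-maximum P? P0 N λ m q → ≤-pred (≤∧≢⇒< (bound m q) λ { refl → ¬p q })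

minimum : {P : ℕ → Set} → Decidable P → ∀ N → P N →
          Σ[ r ∈ ℕ ] P r × (∀ m → P m → r ≤ m)
minimum P? zero p = 0 , p , λ _ _ → z≤n
minimum {P} P? (suc N) p with P? 0
... | yes p₀ = 0 , p₀ , λ _ _ → z≤n
... | no ¬p₀ with minimum {P ∘ suc} (P? ∘ suc) N p
... | r , q , least = suc r , q , λ where
        zero p₀ → ⊥-elim (¬p₀ p₀)
        (suc m) pₘ → s≤s (least m pₘ)

module _ {n : ℕ} (G : Graph n) where

  module _ (U : VSet n) where

    IsCrossing : Fin n × Fin n → Set
    IsCrossing (x , y) = U x × ¬ U y × UpperEdge G U x y

    -- All pairwise conditions of `IndMatching` in one predicate on two endpoint pairs, so that one
    -- `subst₂` carries them from a function to its table.
    Compatible : ∀ {k} → Fin k → Fin k → Fin n × Fin n → Fin n × Fin n → Set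
    Compatible i j (x , y) (x′ , y′) =
      (x ≡ x′ → i ≡ j) × (y ≡ y′ → i ≡ j) ×
      (i ≢ j → ¬ UpperEdge G U x x′) × (i ≢ j → ¬ UpperEdge G U x y′) × (i ≢ j → ¬ UpperEdge G U y y′)

    IsIndMatching : ∀ {k} → (Fin k → Fin n × Fin n) → Set
    IsIndMatching e = (∀ i → IsCrossing (e i)) × (∀ i j → Compatible i j (e i) (e j))

  module _ {U : VSet n} where

    fromEdges : ∀ {k} (e : Fin k → Fin n × Fin n) → IsIndMatching U e → IndMatching G U k
    fromEdges e (cross , compat) = record
      { left       = proj₁ ∘ e
      ; right      = proj₂ ∘ e
      ; left∈U     = λ i → proj₁ (cross i)
      ; right∉U    = λ i → proj₁ (proj₂ (cross i))
      ; matchEdge  = λ i → proj₂ (proj₂ (cross i))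
      ; left-inj   = λ i j → proj₁ (compat i j)
      ; right-inj  = λ i j → proj₁ (proj₂ (compat i j))
      ; induced-ll = λ i j → proj₁ (proj₂ (proj₂ (compat i j)))
      ; induced-lr = λ i j → proj₁ (proj₂ (proj₂ (proj₂ (compat i j))))
      ; induced-rr = λ i j → proj₂ (proj₂ (proj₂ (proj₂ (compat i j))))
      }

    edges : ∀ {k} → IndMatching G U k → Fin k → Fin n × Fin n
    edges M i = left i , right i where open IndMatching M

    edges-induced : ∀ {k} (M : IndMatching G U k) → IsIndMatching U (edges M)
    edges-induced M =
      (λ i → left∈U i , right∉U i , matchEdge i) ,
      (λ i j → left-inj i j , right-inj i j , induced-ll i j , induced-lr i j , induced-rr i j)
      where open IndMatching M

    IndMatching-bound : ∀ {k} → IndMatching G U k → k ≤ n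
    IndMatching-bound M = injective⇒≤ (λ {i} {j} → left-inj i j)
      where open IndMatching M

    IndMatching-0 : IndMatching G U 0
    IndMatching-0 = fromEdges (λ ()) ((λ ()) , λ ())

    module _ (U? : Decidable U) where

      UpperEdge? : ∀ x y → Dec (UpperEdge G U x y)
      UpperEdge? x y = (adj G x y Bool.≟ true) ×-dec (U? x ⊎-dec U? y)

      IsIndMatching? : ∀ {k} (e : Fin k → Fin n × Fin n) → Dec (IsIndMatching U e)
      IsIndMatching? e =
        all? (λ i → let (x , y) = e i in U? x ×-dec ¬? (U? y) ×-dec UpperEdge? x y)
        ×-dec
        all? (λ i → all? (λ j → let (x , y) = e i; (x′ , y′) = e j in
          ((x Fin.≟ x′) →-dec (i Fin.≟ j)) ×-dec ((y Fin.≟ y′) →-dec (i Fin.≟ j)) ×-dec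
          (¬? (i Fin.≟ j) →-dec ¬? (UpperEdge? x x′)) ×-dec
          (¬? (i Fin.≟ j) →-dec ¬? (UpperEdge? x y′)) ×-dec
          (¬? (i Fin.≟ j) →-dec ¬? (UpperEdge? y y′))))

      IndMatching? : ∀ k → Dec (IndMatching G U k)
      IndMatching? k =
        map′ (λ { (v , m) → fromEdges (lookup v) m })
             (λ M → tabulate (edges M) , tabulated M)
             (any-Vec? any-pair? (λ v → IsIndMatching? (lookup v)))
        where
        any-pair? : ∀ {P : Fin n × Fin n → Set} → Decidable P → Dec (∃ P)
        any-pair? P? = map′ (λ { (x , y , p) → (x , y) , p }) (λ { ((x , y) , p) → x , y , p })
                            (any? λ x → any? λ y → P? (x , y))
        tabulated : ∀ M → IsIndMatching U (lookup (tabulate (edges M)))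
        tabulated M =
          (λ i → subst (IsCrossing U) (≡-sym (lookup∘tabulate (edges M) i)) (proj₁ (edges-induced M) i)) ,
          (λ i j → subst₂ (Compatible U i j) (≡-sym (lookup∘tabulate (edges M) i))
                          (≡-sym (lookup∘tabulate (edges M) j)) (proj₂ (edges-induced M) i j))

  -- Tabulated orders agree with the original ones only pointwise, so their prefixes are equivalent
  -- predicates rather than equal ones.
  IndMatching-resp : ∀ {U U′ : VSet n} {k} → (∀ v → U v → U′ v) → (∀ v → U′ v → U v) →
                     IndMatching G U k → IndMatching G U′ k
  IndMatching-resp {U} {U′} to from M = record
    { left       = left
    ; right      = right
    ; left∈U     = λ i → to _ (left∈U i)
    ; right∉U    = λ i → right∉U i ∘ from _
    ; matchEdge  = λ i → let (e , _) = matchEdge i in e , inj₁ (to _ (left∈U i))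
    ; left-inj   = left-inj
    ; right-inj  = right-inj
    ; induced-ll = λ i j i≢j → induced-ll i j i≢j ∘ back
    ; induced-lr = λ i j i≢j → induced-lr i j i≢j ∘ back
    ; induced-rr = λ i j i≢j → induced-rr i j i≢j ∘ back
    }
    where
    open IndMatching M
    back : ∀ {x y} → UpperEdge G U′ x y → UpperEdge G U x y
    back (e , inj₁ u) = e , inj₁ (from _ u)
    back (e , inj₂ u) = e , inj₂ (from _ u)

  Cut : (Fin n → Fin n) → ℕ → VSet n
  Cut pos i v = toℕ (pos v) < i

  -- With the cut quantified existentially, r(π) is the largest `m` satisfying this; `suc (toℕ i)`
  -- ranges over 1, ..., n. A mere position function suffices, so tables not yet known to be
  -- permutations can be tested.
  CutMatching : (Fin n → Fin n) → ℕ → Set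
  CutMatching pos m = Σ[ i ∈ Fin n ] IndMatching G (Cut pos (suc (toℕ i))) m

  CutMatching? : ∀ pos → Decidable (CutMatching pos)
  CutMatching? pos m = any? λ i → IndMatching? (λ v → toℕ (pos v) <? suc (toℕ i)) m

  CutMatching-resp : ∀ {pos pos′ : Fin n → Fin n} {m} → (∀ v → pos v ≡ pos′ v) →
                     CutMatching pos m → CutMatching pos′ m
  CutMatching-resp eq (i , M) =
    i , IndMatching-resp (λ v → subst (λ p → toℕ p < suc (toℕ i)) (eq v))
                         (λ v → subst (λ p → toℕ p < suc (toℕ i)) (≡-sym (eq v))) M

  CutMatching-bound : ∀ {pos m} → CutMatching pos m → m ≤ n
  CutMatching-bound (_ , M) = IndMatching-bound M

  Is-r⇒CutMatching : ∀ {π r} → Is-r G π r → CutMatching (π ⟨$⟩ˡ_) r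
  Is-r⇒CutMatching {π} ((suc i , _ , i<n , M , _) , _) =
    fromℕ< i<n , subst (λ j → IndMatching G (Cut (π ⟨$⟩ˡ_) (suc j)) _) (≡-sym (toℕ-fromℕ< i<n)) M

  CutMatching⇒Is-r : ∀ {π r} → CutMatching (π ⟨$⟩ˡ_) r → (∀ m → CutMatching (π ⟨$⟩ˡ_) m → m ≤ r) → Is-r G π r
  CutMatching⇒Is-r {π} {r} (i , M) max =
    (suc (toℕ i) , s≤s z≤n , toℕ<n i , M , λ m N → max m (i , N)) ,
    λ { (suc j) _ j<n rⱼ (N , _) → max rⱼ
         (fromℕ< j<n , subst (λ l → IndMatching G (Cut (π ⟨$⟩ˡ_) (suc l)) rⱼ) (≡-sym (toℕ-fromℕ< j<n)) N) }

  -- `Is-r` bounds only the maximum at each cut, and `M` need not attain it. The maximum exists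
  -- because sizes are at most `n`, and it lies between `m` and `r`.
  Is-r⇒maximal : ∀ {π r} → Is-r G π r → ∀ m → CutMatching (π ⟨$⟩ˡ_) m → m ≤ r
  Is-r⇒maximal {π} {r} (_ , max) m (i , M)
    with bounded-maximum (IndMatching? (λ v → toℕ (π ⟨$⟩ˡ v) <? suc (toℕ i))) IndMatching-0 n (λ _ → IndMatching-bound)
  ... | s , Ms , s-max = ≤-trans (s-max m M) (max (suc (toℕ i)) (s≤s z≤n) (toℕ<n i) s (Ms , s-max))

  Is-r-exists : 1 ≤ n → ∀ π → Σ[ r ∈ ℕ ] Is-r G π r
  Is-r-exists (s≤s z≤n) π
    with bounded-maximum (CutMatching? (π ⟨$⟩ˡ_)) (Fin.zero , IndMatching-0) n (λ _ → CutMatching-bound)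
  ... | r , M , max = r , CutMatching⇒Is-r {π} M max

  -- Orders are searched as pairs of mutually inverse tables.
  WidthAtMost : ℕ → Set
  WidthAtMost k = Σ[ f ∈ Vec (Fin n) n ] Σ[ g ∈ Vec (Fin n) n ]
    (∀ i → lookup f (lookup g i) ≡ i) × (∀ i → lookup g (lookup f i) ≡ i) ×
    (∀ (m : Fin (suc n)) → CutMatching (lookup g) (toℕ m) → toℕ m ≤ k)

  WidthAtMost? : Decidable WidthAtMost
  WidthAtMost? k = any-Vec? any? λ f → any-Vec? any? λ g →
    all? (λ i → lookup f (lookup g i) Fin.≟ i) ×-dec
    all? (λ i → lookup g (lookup f i) Fin.≟ i) ×-dec
    all? (λ m → CutMatching? (lookup g) (toℕ m) →-dec (toℕ m ≤? k))

  Is-r⇒WidthAtMost : ∀ {π r} → Is-r G π r → WidthAtMost r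
  Is-r⇒WidthAtMost {π} isr =
    tabulate (π ⟨$⟩ʳ_) , tabulate (π ⟨$⟩ˡ_) ,
    (λ i → trans (lookup∘tabulate (π ⟨$⟩ʳ_) _) (trans (cong (π ⟨$⟩ʳ_) (lookup∘tabulate (π ⟨$⟩ˡ_) i)) (inverseʳ π))) ,
    (λ i → trans (lookup∘tabulate (π ⟨$⟩ˡ_) _) (trans (cong (π ⟨$⟩ˡ_) (lookup∘tabulate (π ⟨$⟩ʳ_) i)) (inverseˡ π))) ,
    (λ m M → Is-r⇒maximal {π} isr (toℕ m) (CutMatching-resp (lookup∘tabulate (π ⟨$⟩ˡ_)) M))

  WidthAtMost⇒Is-r : 1 ≤ n → ∀ {k} → WidthAtMost k → Σ[ π ∈ Permutation′ n ] Σ[ r ∈ ℕ ] r ≤ k × Is-r G π r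
  WidthAtMost⇒Is-r 1≤n {k} (f , g , fg , gf , small) with Is-r-exists 1≤n (permutation (lookup f) (lookup g) fg gf)
  ... | r , isr = π , r , subst (_≤ k) (toℕ-fromℕ< r<1+n)
                    (small (fromℕ< r<1+n) (subst (CutMatching (lookup g)) (≡-sym (toℕ-fromℕ< r<1+n)) M)) , isr
    where
    π = permutation (lookup f) (lookup g) fg gf
    M = Is-r⇒CutMatching {π} isr
    -- A matching has at most `n` edges, so `r` is among the sizes in `Fin (suc n)` that
    -- `WidthAtMost` tests.
    r<1+n = s≤s (CutMatching-bound {lookup g} M)

  -- The order found for the least admissible `k` has width `r ≤ k`; since `r` is itself admissible,
  -- `k ≤ r`. The identity order supplies the upper end of the search.
  lu-exists : 1 ≤ n → Σ[ k ∈ ℕ ] IsLu G k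
  lu-exists 1≤n with Is-r-exists 1≤n Perm.id
  ... | r₀ , isr₀ with minimum WidthAtMost? r₀ (Is-r⇒WidthAtMost {Perm.id} isr₀)
  ... | k , w , least with WidthAtMost⇒Is-r 1≤n w
  ... | π , r , r≤k , isr = k , (π , subst (Is-r G π) (≤-antisym r≤k (least r (Is-r⇒WidthAtMost {π} isr))) isr) ,
                            λ π′ r′ isr′ → least r′ (Is-r⇒WidthAtMost {π′} isr′)

-- The lower bound

funToFin-cong : ∀ {m k} {f g : Fin m → Fin k} → (∀ i → f i ≡ g i) → funToFin f ≡ funToFin g
funToFin-cong {zero} eq = refl
funToFin-cong {suc m} eq = cong₂ Fin.combine (eq Fin.zero) (funToFin-cong (eq ∘ Fin.suc))

branch-injective : ∀ {n m} {v v′ : Fin n} {lo lo′ hi hi′ : Fin m} → branch v lo hi ≡ branch v′ lo′ hi′ →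
                   v ≡ v′ × lo ≡ lo′ × hi ≡ hi′
branch-injective refl = refl , refl , refl

-- Computations of an OBDD cut at a prefix of its order

module _ {n : ℕ} (B : OBDD n) where

  private
    pos : Fin n → ℕ
    pos v = toℕ (order B ⟨$⟩ˡ v)

  -- The leaf at `y` excludes the empty path, and the label of `x` with its value determines the
  -- first step.
  Path-unstepT : ∀ {S x v lo hi y} → node B x ≡ branch v lo hi → node B y ≡ leaf true → S v ≡ true →
                 Path B S x y → Path B S hi y
  Path-unstepT eq leafy s (here _) with () ← trans (≡-sym eq) leafy
  Path-unstepT eq leafy s (stepT x _ _ _ y eq′ s′ p) with refl , refl , refl ← branch-injective (trans (≡-sym eq) eq′) = p
  Path-unstepT eq leafy s (stepF x _ _ _ y eq′ s′ p) with refl , refl , refl ← branch-injective (trans (≡-sym eq) eq′)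
    with () ← trans (≡-sym s) s′

  Path-unstepF : ∀ {S x v lo hi y} → node B x ≡ branch v lo hi → node B y ≡ leaf true → S v ≡ false →
                 Path B S x y → Path B S lo y
  Path-unstepF eq leafy s (here _) with () ← trans (≡-sym eq) leafy
  Path-unstepF eq leafy s (stepF x _ _ _ y eq′ s′ p) with refl , refl , refl ← branch-injective (trans (≡-sym eq) eq′) = p
  Path-unstepF eq leafy s (stepT x _ _ _ y eq′ s′ p) with refl , refl , refl ← branch-injective (trans (≡-sym eq) eq′)
    with () ← trans (≡-sym s) s′

  LabelsFrom : ℕ → Fin (size B) → Set
  LabelsFrom i x = ∀ v lo hi → node B x ≡ branch v lo hi → i ≤ pos v

  LabelsFrom-child : ∀ {i x v lo hi c} → node B x ≡ branch v lo hi → c ≡ lo ⊎ c ≡ hi → i ≤ pos v →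
                     LabelsFrom (suc i) c
  LabelsFrom-child eq child i≤v w l h eq′ = ≤-trans (s≤s i≤v) (ordered B _ _ _ _ eq _ child w l h eq′)

  Path-resp : ∀ {i S S′ x y} → (∀ v → i ≤ pos v → S v ≡ S′ v) → LabelsFrom i x →
              Path B S x y → Path B S′ x y
  Path-resp agree from (here x) = here x
  Path-resp {i} agree from (stepT x v lo hi y eq s p) =
    stepT x v lo hi y eq (trans (≡-sym (agree v i≤v)) s)
      (Path-resp agree (λ w l h e → <⇒≤ (LabelsFrom-child eq (inj₂ refl) i≤v w l h e)) p)
    where i≤v = from v lo hi eq
  Path-resp {i} agree from (stepF x v lo hi y eq s p) =
    stepF x v lo hi y eq (trans (≡-sym (agree v i≤v)) s)
      (Path-resp agree (λ w l h e → <⇒≤ (LabelsFrom-child eq (inj₁ refl) i≤v w l h e)) p)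
    where i≤v = from v lo hi eq

  -- exit is where the computation from x leaves the variables before position i; any assignment A that
  -- agrees with S on these variables passes through it.
  record Exit (i : ℕ) (S : Assignment n) (x : Fin (size B)) : Set where
    field
      exit     : Fin (size B)
      beyond   : LabelsFrom i exit
      forward  : ∀ A → (∀ v → pos v < i → A v ≡ S v) → Path B A x (trueSink B) → Path B A exit (trueSink B)
      backward : ∀ A → (∀ v → pos v < i → A v ≡ S v) → Path B A exit (trueSink B) → Path B A x (trueSink B)

  -- `j` bounds the next label position from below and grows by one per step while `fuel` shrinks;
  -- once `fuel` is spent, a branch node would need a position of at least `n`.
  exit-exists : ∀ fuel {j} i S x → n ≤ j + fuel → LabelsFrom j x → Exit i S x
  exit-exists fuel i S x n≤ from with node B x in eq
  ... | leaf b = record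
    { exit = x ; beyond = λ v lo hi e → case-leaf (trans (≡-sym eq) e) ; forward = λ _ _ p → p ; backward = λ _ _ p → p }
    where
    case-leaf : ∀ {b v lo hi} {A : Set} → leaf b ≡ Node.branch {n} {size B} v lo hi → A
    case-leaf ()
  ... | branch v lo hi with pos v <? i
  ... | no v≮i = record
    { exit = x
    ; beyond = λ w l h e → subst (λ u → i ≤ pos u) (proj₁ (branch-injective (trans (≡-sym eq) e))) (≮⇒≥ v≮i)
    ; forward = λ _ _ p → p ; backward = λ _ _ p → p }
  exit-exists zero {j} i S x n≤ from | branch v lo hi | yes v<i =
    ⊥-elim (<⇒≱ (toℕ<n (order B ⟨$⟩ˡ v))
                (≤-trans n≤ (≤-trans (≤-reflexive (+-identityʳ j)) (from v lo hi refl))))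
  exit-exists (suc fuel) {j} i S x n≤ from | branch v lo hi | yes v<i with S v in s
  ... | true = record
    { exit = exit ; beyond = beyond
    ; forward = λ A agree p → forward A agree
        (Path-unstepT eq (trueSink-leaf B) (trans (agree v v<i) s) p)
    ; backward = λ A agree p → stepT x v lo hi _ eq (trans (agree v v<i) s) (backward A agree p) }
    where
    open Exit (exit-exists fuel {suc j} i S hi (≤-trans n≤ (≤-reflexive (+-suc j fuel)))
                           (LabelsFrom-child eq (inj₂ refl) (from v lo hi refl)))
  ... | false = record
    { exit = exit ; beyond = beyond
    ; forward = λ A agree p → forward A agree
        (Path-unstepF eq (trueSink-leaf B) (trans (agree v v<i) s) p)
    ; backward = λ A agree p → stepF x v lo hi _ eq (trans (agree v v<i) s) (backward A agree p) }
    where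
    open Exit (exit-exists fuel {suc j} i S lo (≤-trans n≤ (≤-reflexive (+-suc j fuel)))
                           (LabelsFrom-child eq (inj₁ refl) (from v lo hi refl)))

  exits : ∀ i S → Exit i S (source B)
  exits i S = exit-exists n {0} i S (source B) ≤-refl (λ _ _ _ _ → z≤n)

  -- Splicing: after a common exit only variables from position `i` on are read, and there `A` and
  -- `A′` coincide, so the accepting end of one computation serves the other.
  exit-separates : ∀ i (S S′ A A′ : Assignment n) →
    (∀ v → pos v < i → A v ≡ S v) → (∀ v → pos v < i → A′ v ≡ S′ v) → (∀ v → i ≤ pos v → A v ≡ A′ v) →
    Exit.exit (exits i S) ≡ Exit.exit (exits i S′) → Accepts B A → Accepts B A′
  exit-separates i S S′ A A′ AS AS′ AA′ eq acc =
    Exit.backward (exits i S′) A′ AS′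
      (subst (λ y → Path B A′ y (trueSink B)) eq
        (Path-resp AA′ (Exit.beyond (exits i S)) (Exit.forward (exits i S) A AS acc)))

-- Fooling assignments from an induced matching

module _ {n : ℕ} (G : Graph n) (B : OBDD n) (rep : Represents B G)
         {i r : ℕ} (M : IndMatching G (Prefix (order B) i) r) where

  open IndMatching M
  private
    U : VSet n
    U = Prefix (order B) i

  -- `t` encodes the index set T, with `Fin.zero` for membership; values in `Fin 2` allow the
  -- choices to be counted by `finToFun`.
  Falsified : (Fin r → Fin 2) → Fin n → Set
  Falsified t v = Σ[ l ∈ Fin r ] v ≡ left l × t l ≡ Fin.zero

  Falsified? : ∀ t v → Dec (Falsified t v)
  Falsified? t v = any? λ l → (v Fin.≟ left l) ×-dec (t l Fin.≟ Fin.zero)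

  choice : (Fin r → Fin 2) → Assignment n
  choice t v = not ⌊ Falsified? t v ⌋

  -- Beyond the prefix this falsifies `right j` only, whatever `t` is; exchanging `t` therefore
  -- leaves the outer part unchanged, as splicing requires.
  combined : (Fin r → Fin 2) → Fin r → Assignment n
  combined t j v = choice t v ∧ not ⌊ v Fin.≟ right j ⌋

  choice-outside : ∀ t v → ¬ U v → choice t v ≡ true
  choice-outside t v v∉U with Falsified? t v
  ... | yes (l , refl , _) = ⊥-elim (v∉U (left∈U l))
  ... | no _ = refl

  combined-inside : ∀ t j v → U v → combined t j v ≡ choice t v
  combined-inside t j v v∈U with v Fin.≟ right j
  ... | yes refl = ⊥-elim (right∉U j v∈U)
  ... | no _ = Bool.∧-identityʳ _

  combined-outside : ∀ s t j v → ¬ U v → combined s j v ≡ combined t j v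
  combined-outside s t j v v∉U rewrite choice-outside s v v∉U | choice-outside t v v∉U = refl

  combined-cases : ∀ t j v → combined t j v ≡ true ⊎ Falsified t v ⊎ v ≡ right j
  combined-cases t j v with Falsified? t v | v Fin.≟ right j
  ... | yes f | _ = inj₂ (inj₁ f)
  ... | no _ | yes e = inj₂ (inj₂ e)
  ... | no _ | no _ = inj₁ refl

  combined-right : ∀ t j → combined t j (right j) ≡ false
  combined-right t j with right j Fin.≟ right j
  ... | yes _ = Bool.∧-zeroʳ _
  ... | no ≢ = ⊥-elim (≢ refl)

  combined-left : ∀ t j → t j ≡ Fin.zero → combined t j (left j) ≡ false
  combined-left t j t₀ with Falsified? t (left j)
  ... | yes _ = refl
  ... | no ¬f = ⊥-elim (¬f (j , refl , t₀))

  private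
    edge-sym : ∀ {u v} → Edge G u v → Edge G v u
    edge-sym {u} {v} e = trans (sym G v u) e

    loopless : ∀ {v} → ¬ Edge G v v
    loopless {v} e with () ← trans (≡-sym (irrefl G v)) e

    left-right : ∀ (t : Fin r → Fin 2) j l → t j ≢ Fin.zero → t l ≡ Fin.zero → ¬ Edge G (left l) (right j)
    left-right t j l t≢ t₀ e = induced-lr l j (λ { refl → t≢ t₀ }) (e , inj₁ (left∈U l))

  -- The false vertices are the chosen `left l` and `right j`. An edge between two of them has an
  -- end in the prefix, hence is an upper edge; inducedness leaves only the one from `left j` to
  -- `right j`, and `left j` is not chosen.
  combined-satisfies : ∀ t j → t j ≢ Fin.zero → Satisfiesφ G (combined t j)
  combined-satisfies t j t≢ u v e with combined-cases t j u | combined-cases t j v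
  ... | inj₁ p | _ = inj₁ p
  ... | _ | inj₁ q = inj₂ q
  ... | inj₂ (inj₁ (l , refl , p)) | inj₂ (inj₁ (l′ , refl , q)) with l Fin.≟ l′
  ...   | yes refl = ⊥-elim (loopless e)
  ...   | no l≢l′ = ⊥-elim (induced-ll l l′ l≢l′ (e , inj₁ (left∈U l)))
  combined-satisfies t j t≢ u v e | inj₂ (inj₁ (l , refl , p)) | inj₂ (inj₂ refl) = ⊥-elim (left-right t j l t≢ p e)
  combined-satisfies t j t≢ u v e | inj₂ (inj₂ refl) | inj₂ (inj₁ (l , refl , q)) = ⊥-elim (left-right t j l t≢ q (edge-sym e))
  combined-satisfies t j t≢ u v e | inj₂ (inj₂ refl) | inj₂ (inj₂ refl) = ⊥-elim (loopless e)

  combined-violates : ∀ t j → t j ≡ Fin.zero → ¬ Satisfiesφ G (combined t j)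
  combined-violates t j t₀ sat with sat (left j) (right j) (proj₁ (matchEdge j))
  ... | inj₁ p with () ← trans (≡-sym (combined-left t j t₀)) p
  ... | inj₂ p with () ← trans (≡-sym (combined-right t j)) p

  exitOf : (Fin r → Fin 2) → Fin (size B)
  exitOf t = Exit.exit (exits B i (choice t))

  exitOf-separates : ∀ s t j → s j ≢ Fin.zero → t j ≡ Fin.zero → exitOf s ≢ exitOf t
  exitOf-separates s t j s≢ t₀ eq = combined-violates t j t₀ (Equivalence.to (rep (combined t j))
    (exit-separates B i (choice s) (choice t) (combined s j) (combined t j)
      (combined-inside s j) (combined-inside t j)
      (λ v i≤v → combined-outside s t j v (λ v<i → <⇒≱ v<i i≤v)) eq
      (Equivalence.from (rep (combined s j)) (combined-satisfies s j s≢))))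

  exitOf-injective : ∀ s t → exitOf s ≡ exitOf t → ∀ j → s j ≡ t j
  exitOf-injective s t eq j with s j in es | t j in et
  ... | Fin.zero | Fin.zero = refl
  ... | Fin.suc Fin.zero | Fin.suc Fin.zero = refl
  ... | Fin.suc Fin.zero | Fin.zero = ⊥-elim (exitOf-separates s t j (λ s₀ → Fin.0≢1+n (trans (≡-sym s₀) es)) et eq)
  ... | Fin.zero | Fin.suc Fin.zero = ⊥-elim (exitOf-separates t s j (λ t₀ → Fin.0≢1+n (trans (≡-sym t₀) et)) es (≡-sym eq))

  2^matching≤size : 2 ^ r ≤ size B
  2^matching≤size = injective⇒≤ {f = exitOf ∘ finToFun} λ {s} {t} eq →
    trans (≡-sym (funToFin-finToFin {r} {2} s))
      (trans (funToFin-cong (exitOf-injective (finToFun s) (finToFun t) eq)) (funToFin-finToFin {r} {2} t))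

-- Pruning an independent set to one with private neighbours

AllPairs-lookup : ∀ {A : Set} {R : A → A → Set} → (∀ {x y} → R x y → R y x) → ∀ {xs} → AllPairs R xs →
                  ∀ i j → i ≢ j → R (List.lookup xs i) (List.lookup xs j)
AllPairs-lookup R-sym (rs ∷ ps) Fin.zero Fin.zero i≢j = ⊥-elim (i≢j refl)
AllPairs-lookup R-sym (rs ∷ ps) Fin.zero (Fin.suc j) i≢j = All.lookup rs (∈-lookup j)
AllPairs-lookup R-sym (rs ∷ ps) (Fin.suc i) Fin.zero i≢j = R-sym (All.lookup rs (∈-lookup i))
AllPairs-lookup R-sym (rs ∷ ps) (Fin.suc i) (Fin.suc j) i≢j = AllPairs-lookup R-sym ps i j (i≢j ∘ cong Fin.suc)

false≢true : ∀ {b} → b ≡ false → b ≢ true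
false≢true refl ()

module _ {n : ℕ} (G : Graph n) where

  neighbour : List (Fin n) → Fin n → Bool
  neighbour F w = any (λ u → adj G u w) F

  module _ {U : VSet n} (U? : Decidable U) where

    private
      vertices : List (Fin n × Fin n) → List (Fin n)
      vertices = map proj₁

    -- Only vertices still in `R` are forbidden as further neighbours of `w`; interference within
    -- `P` is left to `Separated`. Once `R` is empty, separation alone makes the partners private.
    Private : List (Fin n) → Fin n × Fin n → Set
    Private R (u , w) = ¬ U w × adj G u w ≡ true × neighbour R w ≡ false

    Separated : Fin n × Fin n → Fin n × Fin n → Set
    Separated (u , w) (u′ , w′) = adj G u w′ ≡ false × adj G u′ w ≡ false

    neighbour-vertices : ∀ P {w} → neighbour (vertices P) w ≡ false → All (λ p → adj G (proj₁ p) w ≡ false) P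
    neighbour-vertices [] _ = []
    neighbour-vertices ((u , _) ∷ P) eq =
      Bool.∨-conicalˡ _ _ eq ∷ neighbour-vertices P (Bool.∨-conicalʳ (adj G u _) _ eq)

    Private-tail : ∀ u R {p} → Private (u ∷ R) p → Private R p
    Private-tail u R {_ , w} (w∉U , edge , none) = w∉U , edge , Bool.∨-conicalʳ (adj G u w) _ none

    -- P lists the vertices already known to be irredundant, each paired with a vertex outside U
    -- that no other vertex of P and R covers.  A vertex of R without such a partner is dropped,
    -- which keeps the neighbourhood and all earlier partners.
    prune : ∀ {Q : VSet n} R P → AllPairs Separated P → All (Private R) P → All Q R → All (Q ∘ proj₁) P →
            Σ[ P′ ∈ List (Fin n × Fin n) ] AllPairs Separated P′ × All (Private []) P′ × All (Q ∘ proj₁) P′ ×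
              (∀ w → ¬ U w → neighbour (vertices P′) w ≡ neighbour R w ∨ neighbour (vertices P) w)
    prune [] P sep priv [] qP = P , sep , priv , qP , λ _ _ → refl
    prune {Q} (u ∷ R) P sep priv (q ∷ qR) qP
      with any? (λ w → ¬? (U? w) ×-dec (adj G u w Bool.≟ true) ×-dec
                       (neighbour R w Bool.≟ false) ×-dec (neighbour (vertices P) w Bool.≟ false))
    ... | yes (w , w∉U , uw , R-w , P-w) =
      let P′ , sep′ , priv′ , qP′ , eq = prune {Q} R ((u , w) ∷ P)
            -- Earlier partners avoid `u` because it was still in the unprocessed list; `w` avoids
            -- the earlier vertices by its choice.
            (All.zipWith (λ { {u′ , w′} ((_ , _ , no-w′) , u′w) → Bool.∨-conicalˡ (adj G u w′) _ no-w′ , u′w })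
               (priv , neighbour-vertices P P-w) ∷ sep)
            ((w∉U , uw , R-w) ∷ All.map (Private-tail u R) priv) qR (q ∷ qP)
      in P′ , sep′ , priv′ , qP′ , λ x x∉U → trans (eq x x∉U)
           (trans (≡-sym (Bool.∨-assoc (neighbour R x) (adj G u x) _))
                  (cong (_∨ neighbour (vertices P) x) (Bool.∨-comm (neighbour R x) (adj G u x))))
    ... | no redundant =
      let P′ , sep′ , priv′ , qP′ , eq = prune {Q} R P sep (All.map (Private-tail u R) priv) qR qP
      in P′ , sep′ , priv′ , qP′ , λ x x∉U → trans (eq x x∉U) (absorb x x∉U)
      where
      absorb : ∀ x → ¬ U x → neighbour R x ∨ neighbour (vertices P) x ≡
                             (adj G u x ∨ neighbour R x) ∨ neighbour (vertices P) x
      -- Dropping `u` could matter only at a vertex outside `U` adjacent to `u` and to no other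
      -- vertex left, and that vertex would be the partner sought.
      absorb x x∉U with adj G u x in ux | neighbour R x in R-x | neighbour (vertices P) x in P-x
      ... | false | _ | _ = refl
      ... | true | true | _ = refl
      ... | true | false | true = refl
      ... | true | false | false = ⊥-elim (redundant (x , x∉U , ux , R-x , P-x))

    -- Left ends are independent, and separation excludes crossing edges and coinciding ends. Right
    -- ends may be adjacent in `G`, but both lie outside `U`, so the upper subgraph lacks that edge.
    private-matching : ∀ {Q : VSet n} → (∀ {u} → Q u → U u) → (∀ {u u′} → Q u → Q u′ → adj G u u′ ≡ false) →
                       ∀ {P} → AllPairs Separated P → All (Private []) P → All (Q ∘ proj₁) P →
                       IndMatching G U (length P)
    private-matching Q⊆U indep {P} sep priv qP = record
      { left       = u
      ; right      = w
      ; left∈U     = λ i → Q⊆U (qu i)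
      ; right∉U    = w∉U
      ; matchEdge  = λ i → uw i , inj₁ (Q⊆U (qu i))
      ; left-inj   = λ i j eq → collide i j λ i≢j →
          false≢true (proj₂ (separated i j i≢j)) (subst (λ x → adj G x (w i) ≡ true) eq (uw i))
      ; right-inj  = λ i j eq → collide i j λ i≢j →
          false≢true (proj₁ (separated i j i≢j)) (subst (λ x → adj G (u i) x ≡ true) eq (uw i))
      ; induced-ll = λ i j _ (e , _) → false≢true (indep (qu i) (qu j)) e
      ; induced-lr = λ i j i≢j (e , _) → false≢true (proj₁ (separated i j i≢j)) e
      ; induced-rr = λ { i j _ (_ , inj₁ x) → w∉U i x ; i j _ (_ , inj₂ x) → w∉U j x }
      }
      where
      u w : Fin (length P) → Fin n
      u i = proj₁ (List.lookup P i)
      w i = proj₂ (List.lookup P i)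
      qu : ∀ i → _
      qu i = All.lookup qP (∈-lookup i)
      w∉U : ∀ i → ¬ U (w i)
      w∉U i = proj₁ (All.lookup priv (∈-lookup i))
      uw : ∀ i → adj G (u i) (w i) ≡ true
      uw i = proj₁ (proj₂ (All.lookup priv (∈-lookup i)))
      separated : ∀ i j → i ≢ j → adj G (u i) (w j) ≡ false × adj G (u j) (w i) ≡ false
      separated = AllPairs-lookup swap sep
      collide : ∀ i j → ¬ (i ≢ j) → i ≡ j
      collide i j ¬≢ with i Fin.≟ j
      ... | yes eq = eq
      ... | no ≢ = ⊥-elim (¬≢ ≢)

    small-neighbourhood : ∀ {Q : VSet n} {k} → (∀ {u} → Q u → U u) →
      (∀ {u u′} → Q u → Q u′ → adj G u u′ ≡ false) → (∀ m → IndMatching G U m → m ≤ k) →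
      ∀ F → All Q F →
      Σ[ F′ ∈ List (Fin n) ] length F′ ≤ k × (∀ w → ¬ U w → neighbour F′ w ≡ neighbour F w)
    small-neighbourhood {Q} {k} Q⊆U indep bound F qF =
      let P , sep , priv , qP , eq = prune {Q} F [] [] [] qF []
      in vertices P ,
         subst (_≤ k) (≡-sym (length-map proj₁ P)) (bound _ (private-matching {Q} Q⊆U indep sep priv qP)) ,
         λ w w∉U → trans (eq w w∉U) (Bool.∨-identityʳ _)

-- The diagram of forced sets along an order

Unique-lookup-injective : ∀ {A : Set} {xs : List A} → Unique xs → ∀ {i j} →
                          List.lookup xs i ≡ List.lookup xs j → i ≡ j
Unique-lookup-injective uniq {i} {j} eq with i Fin.≟ j
... | yes p = p
... | no i≢j = ⊥-elim (AllPairs-lookup (_∘ ≡-sym) uniq i j i≢j eq)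

Unique-⊆-length : ∀ {A : Set} {xs ys : List A} → Unique xs → (∀ {x} → x ∈ xs → x ∈ ys) → length xs ≤ length ys
Unique-⊆-length {xs = xs} {ys} uniq sub = injective⇒≤ {f = λ i → Any.index (sub (∈-lookup i))} λ {i} {j} eq →
  Unique-lookup-injective uniq
    (trans (lookup-index (sub (∈-lookup i)))
      (trans (cong (List.lookup ys) eq) (≡-sym (lookup-index (sub (∈-lookup j))))))

length-cartesianProductWith : ∀ {A B C : Set} (f : A → B → C) xs ys →
                              length (cartesianProductWith f xs ys) ≡ length xs * length ys
length-cartesianProductWith f [] ys = refl
length-cartesianProductWith f (x ∷ xs) ys =
  trans (length-++ (map (f x) ys)) (cong₂ _+_ (length-map (f x) ys) (length-cartesianProductWith f xs ys))

-- Lists of length at most `k`, with repetitions and in every order: overcounting sets is harmless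
-- for an upper bound.
words : ∀ n → ℕ → List (List (Fin n))
words n zero = [] ∷ []
words n (suc k) = [] ∷ cartesianProductWith _∷_ (allFin n) (words n k)

∈-words : ∀ {n} k (F : List (Fin n)) → length F ≤ k → F ∈ words n k
∈-words zero [] _ = here refl
∈-words (suc k) [] _ = here refl
∈-words (suc k) (u ∷ F) (s≤s le) = there (∈-cartesianProductWith⁺ _∷_ (∈-allFin u) (∈-words k F le))

length-words : ∀ n k → length (words n k) ≤ suc n ^ k
length-words n zero = ≤-refl
length-words n (suc k) = begin
  suc (length (cartesianProductWith _∷_ (allFin n) (words n k)))
    ≡⟨ cong suc (trans (length-cartesianProductWith _∷_ (allFin n) (words n k)) (cong (_* length (words n k)) (length-tabulate {n = n} id))) ⟩
  1 + n * length (words n k)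
    -- `suc n ^ suc k` unfolds to `suc n ^ k + n * suc n ^ k`, whose first summand absorbs the empty
    -- list.
    ≤⟨ +-mono-≤ (m^n>0 (suc n) k) (*-monoʳ-≤ n (length-words n k)) ⟩
  suc n ^ suc k ∎
  where open ≤-Reasoning

module Compile {n : ℕ} (G : Graph n) (π : Permutation′ n) where

  pos : Fin n → ℕ
  pos v = toℕ (π ⟨$⟩ˡ v)

  pos-label : ∀ i → pos (π ⟨$⟩ʳ i) ≡ toℕ i
  pos-label i = cong toℕ (inverseˡ π)

  label-pos : ∀ {i v} → pos v ≡ toℕ i → v ≡ π ⟨$⟩ʳ i
  label-pos {i} {v} eq = trans (≡-sym (inverseʳ π)) (cong (π ⟨$⟩ʳ_) (toℕ-injective eq))

  -- inj₂ (i , W): the next variable is the one at position i, and W is the set of variables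
  -- at positions ≥ i that the values read so far force to be true.
  State : Set
  State = Bool ⊎ (Fin n × Vec Bool n)

  _≟ₛ_ : DecidableEquality State
  _≟ₛ_ = Sum.≡-dec Bool._≟_ (Product.≡-dec Fin._≟_ (Vec.≡-dec Bool._≟_))

  -- Entries before position `j` belong to variables already read; erasing them makes states with
  -- the same remaining forced set equal as data, so that they are merged.
  restrict : ℕ → (Fin n → Bool) → Vec Bool n
  restrict j g = tabulate λ w → g w ∧ ⌊ j ≤? pos w ⌋

  lookup-restrict : ∀ {j} g {w} → j ≤ pos w → lookup (restrict j g) w ≡ g w
  lookup-restrict {j} g {w} j≤ with j ≤? pos w | lookup∘tabulate (λ w → g w ∧ ⌊ j ≤? pos w ⌋) w
  ... | yes _ | eq = trans eq (Bool.∧-identityʳ _)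
  ... | no j≰ | _ = ⊥-elim (j≰ j≤)

  restrict-cong : ∀ {j g h} → (∀ w → j ≤ pos w → g w ≡ h w) → restrict j g ≡ restrict j h
  restrict-cong {j} {g} {h} eq = tabulate-cong pointwise
    where
    pointwise : ∀ w → g w ∧ ⌊ j ≤? pos w ⌋ ≡ h w ∧ ⌊ j ≤? pos w ⌋
    pointwise w with j ≤? pos w
    ... | yes j≤ = cong (_∧ true) (eq w j≤)
    ... | no _ = trans (Bool.∧-zeroʳ _) (≡-sym (Bool.∧-zeroʳ _))

  state : ℕ → (Fin n → Bool) → State
  state j g with j <? n
  ... | yes j<n = inj₂ (fromℕ< j<n , restrict j g)
  ... | no _ = inj₁ true

  state-toℕ : ∀ i g → state (toℕ i) g ≡ inj₂ (i , restrict (toℕ i) g)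
  state-toℕ i g with toℕ i <? n
  ... | yes i<n = cong (λ i′ → inj₂ (i′ , restrict (toℕ i) g)) (fromℕ<-toℕ i i<n)
  ... | no i≮n = ⊥-elim (i≮n (toℕ<n i))

  state-n : ∀ g → state n g ≡ inj₁ true
  state-n g with n <? n
  ... | yes n<n = ⊥-elim (<-irrefl refl n<n)
  ... | no _ = refl

  low high : Fin n → Vec Bool n → State
  low i W = if lookup W v then inj₁ false else state (suc (toℕ i)) (λ w → lookup W w ∨ adj G v w)
    where v = π ⟨$⟩ʳ i
  high i W = state (suc (toℕ i)) (lookup W)

  initial : State
  initial = state 0 (λ _ → false)

  -- The level is kept apart from the state because sinks carry no position and the false sink can
  -- occur at several levels.
  data Reach : ℕ → State → Set where
    start   : Reach 0 initial
    go-low  : ∀ {j i W} → Reach j (inj₂ (i , W)) → Reach (suc j) (low i W)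
    go-high : ∀ {j i W} → Reach j (inj₂ (i , W)) → Reach (suc j) (high i W)

  -- The invariant behind the counting: `F` is the set of vertices read as false, and its
  -- independence is what pruning needs.
  Forces : ℕ → Fin n × Vec Bool n → Set
  Forces j (i , W) = toℕ i ≡ j × Σ[ F ∈ List (Fin n) ]
    (∀ {u} → u ∈ F → pos u < j) × (∀ {u u′} → u ∈ F → u′ ∈ F → adj G u u′ ≡ false) ×
    W ≡ restrict j (neighbour G F)

  Shape : ℕ → State → Set
  Shape j (inj₁ _) = ⊤
  Shape j (inj₂ s) = Forces j s

  state-Shape : ∀ {j g} F → (∀ {u} → u ∈ F → pos u < j) → (∀ {u u′} → u ∈ F → u′ ∈ F → adj G u u′ ≡ false) →
                (∀ w → j ≤ pos w → g w ≡ neighbour G F w) → Shape j (state j g)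
  state-Shape {j} F before indep eq with j <? n
  ... | yes j<n = toℕ-fromℕ< j<n , F , before , indep , restrict-cong eq
  ... | no _ = tt

  neighbour-∈ : ∀ F {w} → neighbour G F w ≡ false → ∀ {u} → u ∈ F → adj G u w ≡ false
  neighbour-∈ (u ∷ F) eq (here refl) = Bool.∨-conicalˡ _ _ eq
  neighbour-∈ (u ∷ F) {w} eq (there m) = neighbour-∈ F (Bool.∨-conicalʳ (adj G u w) _ eq) m

  -- A vertex read as false while not forced has no neighbour in `F`, so `F` stays independent when
  -- it is added; a vertex read as true leaves `F` unchanged.
  Reach-Shape : ∀ {j s} → Reach j s → Shape j s
  Reach-Shape start = state-Shape [] (λ ()) (λ ()) (λ _ _ → refl)
  Reach-Shape (go-high {i = i} r) with Reach-Shape r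
  ... | refl , F , before , indep , refl =
    state-Shape F (m≤n⇒m≤1+n ∘ before) indep (λ w i<w → lookup-restrict (neighbour G F) (<⇒≤ i<w))
  Reach-Shape (go-low {i = i} {W} r) with Reach-Shape r
  ... | refl , F , before , indep , refl with lookup W (π ⟨$⟩ʳ i) in W-v
  ... | true = tt
  ... | false = state-Shape (v ∷ F) before′ indep′ λ w i<w →
        trans (cong (_∨ adj G v w) (lookup-restrict (neighbour G F) (<⇒≤ i<w))) (Bool.∨-comm _ (adj G v w))
    where
    v = π ⟨$⟩ʳ i
    apart : ∀ {u} → u ∈ F → adj G u v ≡ false
    apart = neighbour-∈ F (trans (≡-sym (lookup-restrict (neighbour G F) (≤-reflexive (≡-sym (pos-label i))))) W-v)
    before′ : ∀ {u} → u ∈ v ∷ F → pos u < suc (toℕ i)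
    before′ (here refl) = s≤s (≤-reflexive (pos-label i))
    before′ (there m) = m≤n⇒m≤1+n (before m)
    indep′ : ∀ {u u′} → u ∈ v ∷ F → u′ ∈ v ∷ F → adj G u u′ ≡ false
    indep′ (here refl) (here refl) = irrefl G v
    indep′ (here refl) (there m) = trans (sym G v _) (apart m)
    indep′ (there m) (here refl) = apart m
    indep′ (there m) (there m′) = indep m m′

  Reach-level : ∀ {j i W} → Reach j (inj₂ (i , W)) → toℕ i ≡ j
  Reach-level r = proj₁ (Reach-Shape r)

  Reach-bound : ∀ {j s} → Reach j s → j ≤ n
  Reach-bound start = z≤n
  Reach-bound (go-low {i = i} r) with refl ← Reach-level r = toℕ<n i
  Reach-bound (go-high {i = i} r) with refl ← Reach-level r = toℕ<n i

  Reach-parent : ∀ {j s} → Reach j s → s ≡ initial ⊎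
                 (Σ[ j′ ∈ ℕ ] Σ[ i ∈ Fin n ] Σ[ W ∈ Vec Bool n ] Reach j′ (inj₂ (i , W)) × (low i W ≡ s ⊎ high i W ≡ s))
  Reach-parent start = inj₁ refl
  Reach-parent (go-low r) = inj₂ (_ , _ , _ , r , inj₁ refl)
  Reach-parent (go-high r) = inj₂ (_ , _ , _ , r , inj₂ refl)

  -- Enumeration and counting of the reached states

  successors : State → List State
  successors (inj₁ _) = []
  successors (inj₂ (i , W)) = low i W ∷ high i W ∷ []

  layer : ℕ → List State
  layer zero = initial ∷ []
  layer (suc j) = concatMap successors (layer j)

  layer-complete : ∀ {j s} → Reach j s → s ∈ layer j
  layer-complete start = here refl
  layer-complete (go-low r) = ∈-concatMap⁺ successors (lose (layer-complete r) (here refl))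
  layer-complete (go-high r) = ∈-concatMap⁺ successors (lose (layer-complete r) (there (here refl)))

  layer-sound : ∀ j {s} → s ∈ layer j → Reach j s
  layer-sound zero (here refl) = start
  layer-sound (suc j) m with find (∈-concatMap⁻ successors {xs = layer j} m)
  ... | inj₂ (i , W) , m′ , here refl = go-low (layer-sound j m′)
  ... | inj₂ (i , W) , m′ , there (here refl) = go-high (layer-sound j m′)

  states : List State
  states = deduplicate _≟ₛ_ (concat (applyUpTo layer (suc n)))

  states-unique : Unique states
  states-unique = deduplicate-! _≟ₛ_ (concat (applyUpTo layer (suc n)))

  states-complete : ∀ {j s} → Reach j s → s ∈ states
  states-complete r = ∈-deduplicate⁺ _≟ₛ_ (∈-concat⁺′ (layer-complete r) (∈-applyUpTo⁺ layer (s≤s (Reach-bound r))))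

  states-sound : ∀ {s} → s ∈ states → Σ[ j ∈ ℕ ] Reach j s
  states-sound m with ∈-concat⁻′ (applyUpTo layer (suc n)) (∈-deduplicate⁻ _≟ₛ_ (concat (applyUpTo layer (suc n))) m)
  ... | _ , m′ , m″ with ∈-applyUpTo⁻ layer m″
  ... | j , _ , refl = j , layer-sound j m′

  -- Apart from the two sinks, a state is determined by its position and, after pruning, by a list
  -- of at most `k` vertices with the same unread neighbours.
  states-length : ∀ {k} → (∀ j → j ≤ n → ∀ m → IndMatching G (Prefix π j) m → m ≤ k) →
                  length states ≤ 2 + n * suc n ^ k
  states-length {k} bound = begin
    length states ≤⟨ Unique-⊆-length states-unique coded ⟩
    2 + length (cartesianProductWith code (allFin n) (words n k))
      ≡⟨ cong (2 +_) (trans (length-cartesianProductWith code (allFin n) (words n k)) (cong (_* length (words n k)) (length-tabulate {n = n} id))) ⟩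
    2 + n * length (words n k) ≤⟨ s≤s (s≤s (*-monoʳ-≤ n (length-words n k))) ⟩
    2 + n * suc n ^ k ∎
    where
    open ≤-Reasoning
    code : Fin n → List (Fin n) → State
    code i F = inj₂ (i , restrict (toℕ i) (neighbour G F))
    coded : ∀ {s} → s ∈ states → s ∈ inj₁ true ∷ inj₁ false ∷ cartesianProductWith code (allFin n) (words n k)
    coded {inj₁ true} _ = here refl
    coded {inj₁ false} _ = there (here refl)
    coded {inj₂ (i , W)} m with states-sound m
    ... | _ , r with Reach-Shape r
    ... | refl , F , before , indep , refl
      with small-neighbourhood G {Prefix π (toℕ i)} (λ v → pos v <? toℕ i) {_∈ F} before indep
             (bound (toℕ i) (<⇒≤ (toℕ<n i))) F (All.tabulate id)
    ... | F′ , small , eq = there (there (subst (_∈ cartesianProductWith code (allFin n) (words n k))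
      (cong (λ W → inj₂ (i , W)) (restrict-cong λ w i≤w → eq w λ w<i → <⇒≱ w<i i≤w))
      (∈-cartesianProductWith⁺ code (∈-allFin i) (∈-words k F′ small))))

  -- Reachability of both sinks

  data Level : ℕ → Set where
    last  : Level n
    inner : (i : Fin n) → Level (toℕ i)

  level : ∀ {j} → j ≤ n → Level j
  level j≤n with m≤n⇒m<n∨m≡n j≤n
  ... | inj₁ j<n = subst Level (toℕ-fromℕ< j<n) (inner (fromℕ< j<n))
  ... | inj₂ refl = last

  -- Reading true for every remaining variable falsifies no clause; `d` bounds the number of
  -- positions left.
  reach-true : ∀ d {j} g → n ≤ j + d → Reach j (state j g) → Σ[ j′ ∈ ℕ ] Reach j′ (inj₁ true)
  reach-true d g n≤ r with level (Reach-bound r)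
  ... | last = n , subst (Reach n) (state-n g) r
  reach-true zero g n≤ r | inner i = ⊥-elim (<⇒≱ (toℕ<n i) (≤-trans n≤ (≤-reflexive (+-identityʳ _))))
  reach-true (suc d) g n≤ r | inner i =
    reach-true d _ (≤-trans n≤ (≤-reflexive (+-suc _ d))) (go-high (subst (Reach (toℕ i)) (state-toℕ i g) r))

  -- High branches keep `v` forced until its position comes up, where the low branch falsifies a
  -- clause.
  reach-false : ∀ d {j} g v → pos v ≤ j + d → j ≤ pos v → g v ≡ true → Reach j (state j g) →
                Σ[ j′ ∈ ℕ ] Reach j′ (inj₁ false)
  reach-false d g v ≤d ≥j gv r with level (Reach-bound r)
  ... | last = ⊥-elim (<⇒≱ (toℕ<n (π ⟨$⟩ˡ v)) ≥j)
  ... | inner i with m≤n⇒m<n∨m≡n ≥j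
  ... | inj₂ eq = _ , subst (Reach (suc (toℕ i))) low≡ (go-low (subst (Reach (toℕ i)) (state-toℕ i g) r))
    where
    low≡ : low i (restrict (toℕ i) g) ≡ inj₁ false
    low≡ rewrite ≡-sym (label-pos (≡-sym eq)) | lookup-restrict g ≥j | gv = refl
  reach-false zero g v ≤d ≥j gv r | inner i | inj₁ <v =
    ⊥-elim (<⇒≱ <v (≤-trans ≤d (≤-reflexive (+-identityʳ _))))
  reach-false (suc d) g v ≤d ≥j gv r | inner i | inj₁ <v =
    reach-false d _ v (≤-trans ≤d (≤-reflexive (+-suc _ d))) <v (trans (lookup-restrict g ≥j) gv)
      (go-high (subst (Reach (toℕ i)) (state-toℕ i g) r))

  -- The false sink has to be a reached node of the diagram. Reading the first vertex as false
  -- forces its neighbour `u`, and `reach-false` applies.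
  Edge⇒reach-false : ∀ (i : Fin n) → toℕ i ≡ 0 → ∀ u → Edge G (π ⟨$⟩ʳ i) u → Σ[ j ∈ ℕ ] Reach j (inj₁ false)
  Edge⇒reach-false i i≡0 u e =
    reach-false (pos u) _ u (m≤n⇒m≤1+n (m≤n+m (pos u) (toℕ i))) after
      (trans (cong (lookup W u ∨_) e) (Bool.∨-zeroʳ _)) (subst (Reach (suc (toℕ i))) low≡ (go-low r))
    where
    v = π ⟨$⟩ʳ i
    W = restrict (toℕ i) (λ _ → false)
    r : Reach (toℕ i) (inj₂ (i , W))
    r = subst (Reach (toℕ i)) (state-toℕ i (λ _ → false))
          (subst (λ j → Reach j (state j (λ _ → false))) (≡-sym i≡0) start)
    low≡ : low i W ≡ state (suc (toℕ i)) (λ w → lookup W w ∨ adj G v w)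
    low≡ rewrite lookup-restrict {toℕ i} (λ _ → false) {v} (≤-reflexive (≡-sym (pos-label i))) = refl
    after : toℕ i < pos u
    after = ≤∧≢⇒< (subst (_≤ pos u) (≡-sym i≡0) z≤n)
      λ eq → false≢true (irrefl G v) (subst (Edge G v) (label-pos (≡-sym eq)) e)

  -- The residual function: clauses with one end read as false have become demands of `g`, clauses
  -- with an end read as true are gone, the others lie among unread variables.
  Satisfies : ℕ → (Fin n → Bool) → Assignment n → Set
  Satisfies j g S = (∀ w → j ≤ pos w → g w ≡ true → S w ≡ true) ×
    (∀ u w → j ≤ pos u → j ≤ pos w → Edge G u w → S u ≡ true ⊎ S w ≡ true)

  private
    label-or-later : ∀ i w → toℕ i ≤ pos w → w ≡ π ⟨$⟩ʳ i ⊎ toℕ i < pos w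
    label-or-later i w i≤w with m≤n⇒m<n∨m≡n i≤w
    ... | inj₁ i<w = inj₂ i<w
    ... | inj₂ eq = inj₁ (label-pos (≡-sym eq))

  module _ (S : Assignment n) (i : Fin n) (g : Fin n → Bool) where

    private
      v = π ⟨$⟩ʳ i
      W = restrict (toℕ i) g

    Satisfies-high⁺ : Satisfies (toℕ i) g S → Satisfies (suc (toℕ i)) (lookup W) S
    Satisfies-high⁺ (forced , clauses) =
      (λ w i<w Ww → forced w (<⇒≤ i<w) (trans (≡-sym (lookup-restrict g (<⇒≤ i<w))) Ww)) ,
      (λ u w i<u i<w → clauses u w (<⇒≤ i<u) (<⇒≤ i<w))

    Satisfies-high⁻ : S v ≡ true → Satisfies (suc (toℕ i)) (lookup W) S → Satisfies (toℕ i) g S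
    Satisfies-high⁻ Sv (forced , clauses) = forced′ , clauses′
      where
      forced′ : ∀ w → toℕ i ≤ pos w → g w ≡ true → S w ≡ true
      forced′ w i≤w gw with label-or-later i w i≤w
      ... | inj₁ refl = Sv
      ... | inj₂ i<w = forced w i<w (trans (lookup-restrict g i≤w) gw)
      clauses′ : ∀ u w → toℕ i ≤ pos u → toℕ i ≤ pos w → Edge G u w → S u ≡ true ⊎ S w ≡ true
      clauses′ u w i≤u i≤w e with label-or-later i u i≤u | label-or-later i w i≤w
      ... | inj₁ refl | _ = inj₁ Sv
      ... | _ | inj₁ refl = inj₂ Sv
      ... | inj₂ i<u | inj₂ i<w = clauses u w i<u i<w e

    Satisfies-low⁺ : S v ≡ false → Satisfies (toℕ i) g S → Satisfies (suc (toℕ i)) (λ w → lookup W w ∨ adj G v w) S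
    Satisfies-low⁺ Sv (forced , clauses) = forced′ , (λ u w i<u i<w → clauses u w (<⇒≤ i<u) (<⇒≤ i<w))
      where
      forced′ : ∀ w → suc (toℕ i) ≤ pos w → lookup W w ∨ adj G v w ≡ true → S w ≡ true
      forced′ w i<w or with adj G v w in e
      ... | false = forced w (<⇒≤ i<w)
                      (trans (≡-sym (lookup-restrict g (<⇒≤ i<w))) (trans (≡-sym (Bool.∨-identityʳ _)) or))
      ... | true with clauses v w (≤-reflexive (≡-sym (pos-label i))) (<⇒≤ i<w) e
      ... | inj₁ Sv′ = ⊥-elim (false≢true Sv Sv′)
      ... | inj₂ Sw = Sw

    -- A clause meeting `v` holds because its other end has become forced; a demand on `v` itself is
    -- excluded by the first hypothesis.
    Satisfies-low⁻ : lookup W v ≡ false → Satisfies (suc (toℕ i)) (λ w → lookup W w ∨ adj G v w) S →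
                     Satisfies (toℕ i) g S
    Satisfies-low⁻ Wv (forced , clauses) = forced′ , clauses′
      where
      adjacent : ∀ w → toℕ i < pos w → Edge G v w → S w ≡ true
      adjacent w i<w e = forced w i<w (trans (cong (lookup W w ∨_) e) (Bool.∨-zeroʳ _))
      forced′ : ∀ w → toℕ i ≤ pos w → g w ≡ true → S w ≡ true
      forced′ w i≤w gw with label-or-later i w i≤w
      ... | inj₁ refl = ⊥-elim (false≢true Wv (trans (lookup-restrict g i≤w) gw))
      ... | inj₂ i<w = forced w i<w (cong (_∨ adj G v w) (trans (lookup-restrict g i≤w) gw))
      clauses′ : ∀ u w → toℕ i ≤ pos u → toℕ i ≤ pos w → Edge G u w → S u ≡ true ⊎ S w ≡ true
      clauses′ u w i≤u i≤w e with label-or-later i u i≤u | label-or-later i w i≤w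
      ... | inj₁ refl | inj₁ refl = ⊥-elim (false≢true (irrefl G v) e)
      ... | inj₁ refl | inj₂ i<w = inj₂ (adjacent w i<w e)
      ... | inj₂ i<u | inj₁ refl = inj₁ (adjacent u i<u (trans (sym G v u) e))
      ... | inj₂ i<u | inj₂ i<w = clauses u w i<u i<w e

    Satisfies-forced : lookup W v ≡ true → S v ≡ false → ¬ Satisfies (toℕ i) g S
    Satisfies-forced Wv Sv (forced , _) =
      false≢true Sv (forced v i≤v (trans (≡-sym (lookup-restrict g i≤v)) Wv))
      where i≤v = ≤-reflexive (≡-sym (pos-label i))

  -- The diagram and its correctness

  module Diagram {jt jf : ℕ} (reach-t : Reach jt (inj₁ true)) (reach-f : Reach jf (inj₁ false)) where

    open DecMembership _≟ₛ_ using (_∈?_)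

    -- The value at states that are not reached is irrelevant.
    index : State → Fin (length states)
    index s with s ∈? states
    ... | yes m = Any.index m
    ... | no _ = Any.index (states-complete reach-t)

    lookup-index′ : ∀ {j s} → Reach j s → List.lookup states (index s) ≡ s
    lookup-index′ {s = s} r with s ∈? states
    ... | yes m = ≡-sym (lookup-index m)
    ... | no ∉ = ⊥-elim (∉ (states-complete r))

    reached : ∀ x → Σ[ j ∈ ℕ ] Reach j (List.lookup states x)
    reached x = states-sound (∈-lookup x)

    index-lookup : ∀ {x s} → List.lookup states x ≡ s → x ≡ index s
    index-lookup {x} refl = Unique-lookup-injective states-unique (≡-sym (lookup-index′ (proj₂ (reached x))))

    toNode : State → Node n (length states)
    toNode (inj₁ b) = leaf b
    toNode (inj₂ (i , W)) = branch (π ⟨$⟩ʳ i) (index (low i W)) (index (high i W))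

    node-at : Fin (length states) → Node n (length states)
    node-at x = toNode (List.lookup states x)

    node-index : ∀ {j s} → Reach j s → node-at (index s) ≡ toNode s
    node-index r = cong toNode (lookup-index′ r)

    leaf-state : ∀ {s b} → toNode s ≡ leaf b → s ≡ inj₁ b
    leaf-state {inj₁ b} refl = refl

    state-label : ∀ {j} g {w l h} → toNode (state j g) ≡ branch w l h → pos w ≡ j
    state-label {j} g eq with j <? n
    state-label {j} g refl | yes j<n = trans (pos-label _) (toℕ-fromℕ< j<n)

    low-label : ∀ {i W w l h} → toNode (low i W) ≡ branch w l h → toℕ i < pos w
    low-label {i} {W} eq with lookup W (π ⟨$⟩ʳ i)
    ... | false = ≤-reflexive (≡-sym (state-label _ eq))

    high-label : ∀ {i W w l h} → toNode (high i W) ≡ branch w l h → toℕ i < pos w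
    high-label eq = ≤-reflexive (≡-sym (state-label _ eq))

    child-label : ∀ {j s v lo hi} → Reach j s → toNode s ≡ branch v lo hi → ∀ c → c ≡ lo ⊎ c ≡ hi →
                  ∀ {w l h} → node-at c ≡ branch w l h → pos v < pos w
    child-label {s = inj₂ (i , W)} r refl c (inj₁ refl) eq =
      subst (_< _) (≡-sym (pos-label i)) (low-label {i} {W} (trans (≡-sym (node-index (go-low r))) eq))
    child-label {s = inj₂ (i , W)} r refl c (inj₂ refl) eq =
      subst (_< _) (≡-sym (pos-label i)) (high-label {i} {W} (trans (≡-sym (node-index (go-high r))) eq))

    diagram : OBDD n
    diagram = record
      { size = length states
      ; node = node-at
      ; source = index initial
      ; trueSink = index (inj₁ true)
      ; falseSink = index (inj₁ false)
      ; trueSink-leaf = node-index reach-t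
      ; falseSink-leaf = node-index reach-f
      ; true-unique = λ x eq → index-lookup (leaf-state eq)
      ; false-unique = λ x eq → index-lookup (leaf-state eq)
      ; one-source = parent
      ; order = π
      ; ordered = λ x v lo hi eq c child w l h eq′ → child-label (proj₂ (reached x)) eq c child eq′
      }
      where
      -- Every reached state other than the initial one is a child of a reached state, so there is
      -- no second source.
      parent : ∀ y → y ≢ index initial → _
      parent y y≢ with Reach-parent (proj₂ (reached y))
      ... | inj₁ eq = ⊥-elim (y≢ (index-lookup eq))
      ... | inj₂ (_ , i , W , r , inj₁ eq) =
        index (inj₂ (i , W)) , _ , _ , _ , node-index r , inj₁ (≡-sym (index-lookup (≡-sym eq)))
      ... | inj₂ (_ , i , W , r , inj₂ eq) =
        index (inj₂ (i , W)) , _ , _ , _ , node-index r , inj₂ (≡-sym (index-lookup (≡-sym eq)))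

    Path-leaf : ∀ {S x y b} → node-at x ≡ leaf b → Path diagram S x y → x ≡ y
    Path-leaf eq (here _) = refl
    Path-leaf eq (stepT _ _ _ _ _ eq′ _ _) with () ← trans (≡-sym eq) eq′
    Path-leaf eq (stepF _ _ _ _ _ eq′ _ _) with () ← trans (≡-sym eq) eq′

    ¬Path-false : ∀ {S} → ¬ Path diagram S (index (inj₁ false)) (index (inj₁ true))
    ¬Path-false p with () ← trans (≡-sym (lookup-index′ reach-t))
                              (trans (cong (List.lookup states) (≡-sym (Path-leaf (node-index reach-f) p))) (lookup-index′ reach-f))

    Computes : Assignment n → State → Set → Set
    Computes S s A = (A → Path diagram S (index s) (index (inj₁ true))) × (Path diagram S (index s) (index (inj₁ true)) → A)

    -- Induction on a bound `d` for the levels left: the two branches of a state match the two ways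
    -- its residual function specializes at the variable read.
    computes : ∀ d {j} g S → n ≤ j + d → Reach j (state j g) → Computes S (state j g) (Satisfies j g S)
    computes d g S n≤ r with level (Reach-bound r)
    ... | last rewrite state-n g =
      (λ _ → here _) ,
      (λ _ → (λ w n≤w → ⊥-elim (<⇒≱ (toℕ<n (π ⟨$⟩ˡ w)) n≤w)) , (λ u _ n≤u → ⊥-elim (<⇒≱ (toℕ<n (π ⟨$⟩ˡ u)) n≤u)))
    computes zero g S n≤ r | inner i = ⊥-elim (<⇒≱ (toℕ<n i) (≤-trans n≤ (≤-reflexive (+-identityʳ _))))
    computes (suc d) g S n≤ r | inner i rewrite state-toℕ i g = go
      where
      v = π ⟨$⟩ʳ i
      W = restrict (toℕ i) g
      n≤′ = ≤-trans n≤ (≤-reflexive (+-suc (toℕ i) d))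
      go : Computes S (inj₂ (i , W)) (Satisfies (toℕ i) g S)
      go with S v in Sv
      ... | true = let to , from = computes d (lookup W) S n≤′ (go-high r) in
        (λ sat → stepT _ _ _ _ _ (node-index r) Sv (to (Satisfies-high⁺ S i g sat))) ,
        (λ p → Satisfies-high⁻ S i g Sv (from (Path-unstepT diagram (node-index r) (node-index reach-t) Sv p)))
      ... | false =
        (λ sat → stepF _ _ _ _ _ (node-index r) Sv (proj₁ goLow sat)) ,
        (λ p → proj₂ goLow (Path-unstepF diagram (node-index r) (node-index reach-t) Sv p))
        where
        goLow : Computes S (low i W) (Satisfies (toℕ i) g S)
        -- Reachability of the low child is abstracted together with the test, so that in the
        -- `false` case it becomes reachability of a `state`.
        goLow with lookup W v in Wv | go-low {W = W} r
        ... | true | _ = (λ sat → ⊥-elim (Satisfies-forced S i g Wv Sv sat)) , (λ p → ⊥-elim (¬Path-false p))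
        ... | false | r′ = let to , from = computes d (λ w → lookup W w ∨ adj G v w) S n≤′ r′ in
          to ∘ Satisfies-low⁺ S i g Sv , Satisfies-low⁻ S i g Wv ∘ from

    diagram-represents : Represents diagram G
    diagram-represents S = mk⇔
      (λ p u w e → proj₂ (proj₂ accepted p) u w z≤n z≤n e)
      (λ sat → proj₁ accepted ((λ _ _ ()) , λ u w _ _ → sat u w))
      where accepted = computes n (λ _ → false) S ≤-refl start

-- The bounds

-- `suc n ≤ n * n` turns the count into `2 + n ^ (1 + 2 * k)`; absorbing the summand 2 costs one
-- more factor `n`, and `1 ≤ k` gives 2 + 2k ≤ 4k. Hence the constant 4.
size-estimate : ∀ {n k} → 2 ≤ n → 1 ≤ k → 2 + n * suc n ^ k ≤ n ^ (4 * k)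
size-estimate {suc zero} (s≤s ())
size-estimate {n@(suc (suc _))} {k} 2≤n 1≤k = begin
  2 + n * suc n ^ k                 ≤⟨ +-monoʳ-≤ 2 (*-monoʳ-≤ n power) ⟩
  2 + n ^ (1 + 2 * k)               ≤⟨ +-monoˡ-≤ (n ^ (1 + 2 * k)) (*-mono-≤ 2≤n (m^n>0 n (2 * k))) ⟩
  n ^ (1 + 2 * k) + n ^ (1 + 2 * k) ≡⟨ cong (n ^ (1 + 2 * k) +_) (+-identityʳ _) ⟨
  2 * n ^ (1 + 2 * k)               ≤⟨ *-monoˡ-≤ (n ^ (1 + 2 * k)) 2≤n ⟩
  n ^ (2 + 2 * k)                   ≤⟨ ^-monoʳ-≤ n (+-monoˡ-≤ (2 * k) (*-monoʳ-≤ 2 1≤k)) ⟩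
  n ^ (2 * k + 2 * k)               ≡⟨ cong (n ^_) (*-distribʳ-+ k 2 2) ⟨
  n ^ (4 * k)                       ∎
  where
  open ≤-Reasoning
  power : suc n ^ k ≤ n ^ (2 * k)
  power = begin
    suc n ^ k   ≤⟨ ^-monoˡ-≤ k (+-mono-≤ (≤-trans (n≤1+n 1) 2≤n) (m≤m+n n _)) ⟩
    (n * n) ^ k ≡⟨ cong (λ m → (n * m) ^ k) (*-identityʳ n) ⟨
    (n ^ 2) ^ k ≡⟨ ^-*-assoc n 2 k ⟩
    n ^ (2 * k) ∎

Edge⇒2≤n : ∀ {n} (G : Graph n) {u v} → Edge G u v → 2 ≤ n
Edge⇒2≤n {suc zero} G {Fin.zero} {Fin.zero} e = ⊥-elim (false≢true (irrefl G Fin.zero) e)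
Edge⇒2≤n {suc (suc n)} G e = s≤s (s≤s z≤n)

-- Cut after the first vertex: an edge from it to a neighbour is an induced matching by itself. This
-- supplies the positive exponent that `size-estimate` requires.
Is-r-positive : ∀ {n} (G : Graph (suc n)) → NoIsolated G → ∀ {π r} → Is-r G π r → 1 ≤ r
Is-r-positive {n} G covered {π} isr with covered (π ⟨$⟩ʳ Fin.zero)
... | u , e = Is-r⇒maximal G {π} isr 1 (Fin.zero ,
    private-matching G {U} (λ x → toℕ (π ⟨$⟩ˡ x) <? 1) {_≡ v}
      (λ { refl → s≤s (≤-reflexive first) }) (λ { refl refl → irrefl G v })
      ([] ∷ []) ((u∉U , e , refl) ∷ []) (refl ∷ []))
  where
  v = π ⟨$⟩ʳ Fin.zero
  U = Prefix π 1
  first : toℕ (π ⟨$⟩ˡ v) ≡ 0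
  first = cong toℕ (inverseˡ π)
  u∉U : ¬ U u
  u∉U u<1 = false≢true (irrefl G v) (subst (Edge G v) (Compile.label-pos G π (n<1⇒n≡0 u<1)) e)

Is-r⇒prefix-bound : ∀ {n} (G : Graph n) {π r} → Is-r G π r →
                    ∀ j → j ≤ n → ∀ m → IndMatching G (Prefix π j) m → m ≤ r
-- `Is-r` starts with the prefix of length 1, but states at the first position need the empty
-- prefix, which admits only the empty matching.
Is-r⇒prefix-bound G isr zero _ zero M = z≤n
Is-r⇒prefix-bound G isr zero _ (suc m) M with () ← IndMatching.left∈U M Fin.zero
Is-r⇒prefix-bound G {π} isr (suc j) j<n m M = Is-r⇒maximal G {π} isr m
  (fromℕ< j<n , subst (λ l → IndMatching G (Prefix π (suc l)) m) (≡-sym (toℕ-fromℕ< j<n)) M)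

small-OBDD : ∀ {n} (G : Graph n) → 1 ≤ n → NoIsolated G → ∀ {π r} → Is-r G π r →
             Σ[ B ∈ OBDD n ] Represents B G × size B ≤ n ^ (4 * r)
small-OBDD {n@(suc _)} G _ covered {π} isr =
  diagram , diagram-represents ,
  ≤-trans (states-length (Is-r⇒prefix-bound G {π} isr))
          (size-estimate (Edge⇒2≤n G e) (Is-r-positive G covered {π} isr))
  where
  open Compile G π
  e = proj₂ (covered (π ⟨$⟩ʳ Fin.zero))
  open Diagram (proj₂ (reach-true n (λ _ → false) ≤-refl start))
               (proj₂ (Edge⇒reach-false Fin.zero refl _ e))

-- The order of `B` need not be optimal: its own width is at least `k`, and a matching attaining
-- that width gives the exponent.
large-OBDD : ∀ {n} (G : Graph n) → 1 ≤ n → ∀ {k} → IsLu G k → ∀ B → Represents B G → 2 ^ k ≤ size B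
large-OBDD G 1≤n (_ , least) B rep =
  let r , isr = Is-r-exists G 1≤n (order B)
      _ , M = Is-r⇒CutMatching G {order B} isr
  in ≤-trans (^-monoʳ-≤ 2 (least (order B) r isr)) (2^matching≤size G B rep M)

theorem2 : Σ ℕ λ c → 0 < c ×
    (∀ (n : ℕ) (G : Graph n) → 1 ≤ n → NoIsolated G →
    Σ ℕ λ k → IsLu G k ×
    (∀ (B : OBDD n) → Represents B G → 2 ^ k ≤ size B) ×
    (Σ (OBDD n) λ B → Represents B G × size B ≤ n ^ (c * k)))
theorem2 = 4 , s≤s z≤n , λ n G 1≤n covered →
  let k , lu@((π , isr) , _) = lu-exists G 1≤n
  in k , lu , large-OBDD G 1≤n lu , small-OBDD G 1≤n covered {π} isr
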